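{- If $G\in\mathcal{G}$, then $$\alpha(G)\ge \tfrac{2}{3}|V_1(G)|+\tfrac{1}{3}|V_2(G)|+\tfrac{1}{3}|V_3(G)|,$$ and equality holds if $G\in\mathcal{A}\cup\mathcal{B}$.
   Context: Graphs are finite, simple and undirected. $\mathcal{G}$ denotes the class of all connected graphs $G$ with maximum degree at most $3$, with $G\neq K_4$ and $|V(G)|\ge 3$. For $i\in\{1,2,3\}$, $V_i(G)=\{v\in V(G): d_G(v)=i\}$, where $d_G(v)$ is the degree of $v$. $\alpha(G)$ is the independence number of $G$. The class $\mathcal{A}$ is defined recursively: $K_3\in\mathcal{A}$; and if $G'\in\mathcal{A}$ and $x$ is a vertex of degree $2$ in $G'$, then the graph obtained from the disjoint union of $G'$ and a triangle $K_3$ by adding one edge between $x$ and a vertex of the triangle belongs to $\mathcal{A}$. The class $\mathcal{B}$ consists of all graphs obtained from a path $P_n$ on $n\ge 2$ vertices by attaching one pendant edge (to a new vertex) at every vertex of $P_n$. -}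

module Defs where

open import Data.Nat using (ℕ; zero; suc; _+_; _*_; _≤_; _≡ᵇ_)
open import Data.Bool using (Bool; true; false; if_then_else_; not; _∧_; _∨_)
open import Data.Fin using (Fin; zero; suc; toℕ; splitAt; _≟_)
open import Data.Sum using (_⊎_; inj₁; inj₂)
open import Data.Product using (Σ; _×_; ∃-syntax)
open import Relation.Nullary using (¬_)
open import Relation.Nullary.Decidable using (⌊_⌋)
open import Relation.Binary.PropositionalEquality using (_≡_)

Adj : ℕ → Set
Adj n = Fin n → Fin n → Bool

IsSimple : ∀ {n} → Adj n → Set
IsSimple {n} adj = (∀ i j → adj i j ≡ adj j i) × (∀ i → adj i i ≡ false)

count : ∀ {n} → (Fin n → Bool) → ℕ
count {zero} f = 0
count {suc n} f = (if f zero then 1 else 0) + count (λ i → f (suc i))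

deg : ∀ {n} → Adj n → Fin n → ℕ
deg adj v = count (adj v)

numDeg : ∀ {n} → Adj n → ℕ → ℕ
numDeg adj i = count (λ v → deg adj v ≡ᵇ i)

MaxDegAtMost3 : ∀ {n} → Adj n → Set
MaxDegAtMost3 adj = ∀ v → deg adj v ≤ 3

data Walk {n} (adj : Adj n) : Fin n → Fin n → Set where
  here : ∀ {i} → Walk adj i i
  step : ∀ {i k j} → adj i k ≡ true → Walk adj k j → Walk adj i j

Connected : ∀ {n} → Adj n → Set
Connected adj = ∀ i j → Walk adj i j

Iso : ∀ {n m} → Adj n → Adj m → Set
Iso {n} {m} adj adj' =
  Σ (Fin n → Fin m) λ f → Σ (Fin m → Fin n) λ g →
    (∀ x → g (f x) ≡ x) × (∀ y → f (g y) ≡ y) ×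
    (∀ i j → adj' (f i) (f j) ≡ adj i j)

_==_ : ∀ {n} → Fin n → Fin n → Bool
i == j = ⌊ i ≟ j ⌋

Kadj : (n : ℕ) → Adj n
Kadj n i j = not (i == j)

Independent : ∀ {n} → Adj n → (Fin n → Bool) → Set
Independent adj S = ∀ i j → S i ≡ true → S j ≡ true → adj i j ≡ false

IsIndependenceNumber : ∀ {n} → Adj n → ℕ → Set
IsIndependenceNumber adj k =
  (Σ _ λ S → Independent adj S × count S ≡ k) ×
  (∀ S → Independent adj S → count S ≤ k)

-- Class 𝒜: K3, and attaching a pendant triangle at a degree-2 vertex x.
-- Vertices of the extension: Fin (n + 3) = old vertices ⊎ triangle vertices.
extAdj' : ∀ {n} → Adj n → Fin n → Fin n ⊎ Fin 3 → Fin n ⊎ Fin 3 → Bool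
extAdj' adj x (inj₁ i) (inj₁ j) = adj i j
extAdj' adj x (inj₂ a) (inj₂ b) = not (a == b)
extAdj' adj x (inj₁ i) (inj₂ b) = (i == x) ∧ (b == zero)
extAdj' adj x (inj₂ a) (inj₁ j) = (j == x) ∧ (a == zero)

extA : ∀ {n} → Adj n → Fin n → Adj (n + 3)
extA {n} adj x u v = extAdj' adj x (splitAt n u) (splitAt n v)

data IsA : (n : ℕ) → Adj n → Set where
  base : IsA 3 (Kadj 3)
  ext  : ∀ {n adj} → IsA n adj → (x : Fin n) → deg adj x ≡ 2 → IsA (n + 3) (extA adj x)

InA : ∀ {n} → Adj n → Set
InA adj = Σ ℕ λ m → Σ (Adj m) λ adj' → IsA m adj' × Iso adj adj'

-- Class ℬ: path P_m (vertices inj₁ i) with a pendant vertex inj₂ i at each i.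
bAdj' : ∀ {m} → Fin m ⊎ Fin m → Fin m ⊎ Fin m → Bool
bAdj' (inj₁ i) (inj₁ j) = (suc (toℕ i) ≡ᵇ toℕ j) ∨ (suc (toℕ j) ≡ᵇ toℕ i)
bAdj' (inj₁ i) (inj₂ j) = i == j
bAdj' (inj₂ i) (inj₁ j) = i == j
bAdj' (inj₂ i) (inj₂ j) = false

Badj : (m : ℕ) → Adj (m + m)
Badj m u v = bAdj' (splitAt m u) (splitAt m v)

InB : ∀ {n} → Adj n → Set
InB adj = Σ ℕ λ m → (2 ≤ m) × Iso adj (Badj m)

InG : ∀ {n} → Adj n → Set
InG {n} adj = IsSimple adj × Connected adj × MaxDegAtMost3 adj ×
              (¬ Iso adj (Kadj 4)) × (3 ≤ n)

{-# OPTIONS --safe --termination-depth=2 #-}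

-- No two leaves are adjacent, so each leaf v can be put into an independent set at the price of
-- deleting N[v], which has two vertices; what remains is subcubic without K₄, and such a graph has an
-- independent set of a third of its vertices.  For the latter, a triangle with vertices x and y whose
-- outer neighbours p and q differ is replaced by the edge pq; a K₄ created by this edge comes from a
-- diamond of the old graph, and diamonds are treated first.  A triangle-free graph is handled
-- by deleting closed neighbourhoods, and a vertex of degree at most 2 saves one there.
-- Equality: the graphs in 𝒜 are partitioned into triangles, those in ℬ into m edges.
module Submission where

open import Defs
open import Data.Nat using (ℕ; zero; suc; _+_; _*_; _≤_; _<_; z≤n; s≤s; pred; _≤?_; _≡ᵇ_)
open import Data.Nat.Properties hiding (_≟_; suc-injective)
open import Data.Nat.Tactic.RingSolver using (solve-∀)
open import Data.Bool using (Bool; true; false; T; not; _∧_; _∨_)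
open import Data.Bool.Properties using (∧-conicalˡ; ∧-conicalʳ; ∨-zeroʳ; ∨-comm; ∧-comm; ¬-not; not-injective)
  renaming (_≟_ to _≟ᵇ_)
open import Data.Empty using (⊥)
open import Data.Fin using (Fin; zero; suc; splitAt; _≟_; _↑ˡ_; _↑ʳ_)
open import Data.Fin.Properties using (any?; splitAt-↑ˡ; splitAt-↑ʳ; splitAt⁻¹-↑ˡ; ↑ʳ-injective; suc-injective)
open import Data.List using (List; []; _∷_; length; lookup)
open import Data.List.Relation.Unary.All using (All; []; _∷_)
import Data.List.Relation.Unary.All as All
import Data.List.Relation.Unary.All.Properties as Allₚ
open import Data.List.Relation.Unary.Any using (here; there)
import Data.List.Relation.Unary.Any as Any
import Data.List.Relation.Unary.Any.Properties as Anyₚ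
open import Data.List.Relation.Unary.AllPairs using ([]; _∷_)
open import Data.List.Relation.Unary.Unique.Propositional using (Unique)
import Data.List.Membership.Propositional as List
import Data.List.Membership.DecPropositional as DecMembership
open import Data.Sum using (_⊎_; inj₁; inj₂; [_,_]′)
open import Data.Product using (∃-syntax; _×_; _,_; proj₁)
open import Function using (_∘_)
open import Relation.Nullary using (¬_; yes; no; contradiction; Dec)
open import Relation.Nullary.Decidable using (_×-dec_; ¬?; map′)
open import Relation.Binary.PropositionalEquality

private variable
  n m : ℕ

-- Finite sets as Boolean predicates

Subset : ℕ → Set
Subset n = Fin n → Bool

infix 4 _∈_ _∉_ _⊆_
infixr 6 _∪_
infixr 7 _∩_
infixl 5 _∖_ _-_

_∈_ _∉_ : Fin n → Subset n → Set
v ∈ X = X v ≡ true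
v ∉ X = X v ≡ false

_⊆_ : Subset n → Subset n → Set
X ⊆ Y = ∀ v → v ∈ X → v ∈ Y

∅ full : Subset n
∅ _ = false
full _ = true

⁅_⁆ : Fin n → Subset n
⁅ v ⁆ i = i == v

_∪_ _∩_ _∖_ : Subset n → Subset n → Subset n
(X ∪ Y) i = X i ∨ Y i
(X ∩ Y) i = X i ∧ Y i
(X ∖ Y) i = X i ∧ not (Y i)

_-_ : Subset n → Fin n → Subset n
X - v = X ∖ ⁅ v ⁆

⟦_⟧ : List (Fin n) → Subset n
⟦ [] ⟧ = ∅
⟦ v ∷ l ⟧ = ⁅ v ⁆ ∪ ⟦ l ⟧

==⇒≡ : (i j : Fin n) → (i == j) ≡ true → i ≡ j
==⇒≡ i j e with i ≟ j
... | yes p = p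

==-refl : (i : Fin n) → (i == i) ≡ true
==-refl i with i ≟ i
... | yes _ = refl
... | no i≢i = contradiction refl i≢i

≢⇒==-false : {i j : Fin n} → i ≢ j → (i == j) ≡ false
≢⇒==-false {i = i} {j} i≢j = ¬-not (i≢j ∘ ==⇒≡ i j)

∨-true⁻ : ∀ {a b} → a ∨ b ≡ true → a ≡ true ⊎ b ≡ true
∨-true⁻ {true} _ = inj₁ refl
∨-true⁻ {false} e = inj₂ e

∨-true⁺ʳ : ∀ a {b} → b ≡ true → a ∨ b ≡ true
∨-true⁺ʳ a refl = ∨-zeroʳ a

∨-true⁺ˡ : ∀ {a} b → a ≡ true → a ∨ b ≡ true
∨-true⁺ˡ b refl = refl

true≢false : ∀ {b} → b ≡ true → b ≡ false → ⊥
true≢false refl ()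

∈∖⁻ˡ : (X Y : Subset n) {v : Fin n} → v ∈ X ∖ Y → v ∈ X
∈∖⁻ˡ X Y = ∧-conicalˡ _ _

∈∖⁻ʳ : (X Y : Subset n) {v : Fin n} → v ∈ X ∖ Y → v ∉ Y
∈∖⁻ʳ X Y {v} e with Y v | ∧-conicalʳ (X v) _ e
... | false | _ = refl

∈∖⁺ : (X Y : Subset n) {v : Fin n} → v ∈ X → v ∉ Y → v ∈ X ∖ Y
∈∖⁺ X Y p q = cong₂ _∧_ p (cong not q)

∈-⁺ : (X : Subset n) {v w : Fin n} → w ∈ X → w ≢ v → w ∈ X - v
∈-⁺ X {v} p q = ∈∖⁺ X ⁅ v ⁆ p (≢⇒==-false q)

∈⟦⟧⁻ : (l : List (Fin n)) {v : Fin n} → v ∈ ⟦ l ⟧ → v List.∈ l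
∈⟦⟧⁻ (w ∷ l) {v} e with ∨-true⁻ {v == w} e
... | inj₁ p = here (==⇒≡ v w p)
... | inj₂ p = there (∈⟦⟧⁻ l p)

∈⟦⟧⁺ : (l : List (Fin n)) {v : Fin n} → v List.∈ l → v ∈ ⟦ l ⟧
∈⟦⟧⁺ (w ∷ l) (here refl) = ∨-true⁺ˡ _ (==-refl w)
∈⟦⟧⁺ (w ∷ l) {v} (there p) = ∨-true⁺ʳ (v == w) (∈⟦⟧⁺ l p)

count-∅ : ∀ n → count {n} ∅ ≡ 0
count-∅ zero = refl
count-∅ (suc n) = count-∅ n

count-full : ∀ n → count {n} full ≡ n
count-full zero = refl
count-full (suc n) = cong suc (count-full n)

count-mono : {X Y : Subset n} → X ⊆ Y → count X ≤ count Y
count-mono {zero} _ = z≤n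
count-mono {suc n} {X} {Y} X⊆Y with X zero | Y zero | X⊆Y zero
... | true  | true  | _ = s≤s (count-mono (X⊆Y ∘ suc))
... | true  | false | f = contradiction (f refl) λ ()
... | false | true  | _ = m≤n⇒m≤1+n (count-mono (X⊆Y ∘ suc))
... | false | false | _ = count-mono (X⊆Y ∘ suc)

count-∪-≤ : (X Y : Subset n) → count (X ∪ Y) ≤ count X + count Y
count-∪-≤ {zero} X Y = z≤n
count-∪-≤ {suc n} X Y with X zero | Y zero | count-∪-≤ (X ∘ suc) (Y ∘ suc)
... | true  | true  | ih = s≤s (≤-trans ih (+-monoʳ-≤ _ (n≤1+n _)))
... | true  | false | ih = s≤s ih
... | false | true  | ih = ≤-trans (s≤s ih) (≤-reflexive (sym (+-suc _ _)))
... | false | false | ih = ih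

count-∪-disjoint : (X Y : Subset n) → (∀ v → v ∈ X → v ∉ Y) → count X + count Y ≡ count (X ∪ Y)
count-∪-disjoint {zero} X Y _ = refl
count-∪-disjoint {suc n} X Y d with X zero | Y zero | d zero | count-∪-disjoint (X ∘ suc) (Y ∘ suc) (d ∘ suc)
... | true  | true  | f | _  = contradiction (f refl) λ ()
... | true  | false | _ | ih = cong suc ih
... | false | true  | _ | ih = trans (+-suc _ _) (cong suc ih)
... | false | false | _ | ih = ih

count-⁅⁆ : (v : Fin n) → count ⁅ v ⁆ ≡ 1
count-⁅⁆ {suc n} zero = cong suc (count-∅ n)
count-⁅⁆ {suc n} (suc v) = trans (≤-antisym (count-mono to) (count-mono from)) (count-⁅⁆ v)
  where
  to : (λ i → suc i == suc v) ⊆ ⁅ v ⁆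
  to i e rewrite suc-injective (==⇒≡ (suc i) (suc v) e) = ==-refl v
  from : ⁅ v ⁆ ⊆ (λ i → suc i == suc v)
  from i e rewrite ==⇒≡ i v e = ==-refl (suc v)

count-⟦⟧ : (l : List (Fin n)) → count ⟦ l ⟧ ≤ length l
count-⟦⟧ {n} [] = ≤-reflexive (count-∅ n)
count-⟦⟧ (v ∷ l) = ≤-trans (count-∪-≤ ⁅ v ⁆ ⟦ l ⟧) (+-mono-≤ (≤-reflexive (count-⁅⁆ v)) (count-⟦⟧ l))

count-remove : (X : Subset n) {v : Fin n} → v ∈ X → count X ≡ suc (count (X - v))
count-remove X {v} v∈X = trans (≤-antisym (count-mono to) (count-mono from))
  (trans (sym (count-∪-disjoint ⁅ v ⁆ (X - v) disj)) (cong (_+ count (X - v)) (count-⁅⁆ v)))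
  where
  to : X ⊆ ⁅ v ⁆ ∪ (X - v)
  to i p with i ≟ v
  ... | yes _ = refl
  ... | no _ = cong (_∧ true) p
  from : ⁅ v ⁆ ∪ (X - v) ⊆ X
  from i p with ∨-true⁻ {i == v} p
  ... | inj₁ e rewrite ==⇒≡ i v e = v∈X
  ... | inj₂ e = ∈∖⁻ˡ X ⁅ v ⁆ e
  disj : ∀ i → i ∈ ⁅ v ⁆ → i ∉ X - v
  disj i p = ¬-not λ q → true≢false p (∈∖⁻ʳ X ⁅ v ⁆ q)

count-∖-≤ : (X Y : Subset n) → count X ≤ count (Y ∩ X) + count (X ∖ Y)
count-∖-≤ X Y = ≤-trans (count-mono split) (count-∪-≤ (Y ∩ X) (X ∖ Y))
  where
  split : X ⊆ (Y ∩ X) ∪ (X ∖ Y)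
  split i p with Y i
  ... | true = ∨-true⁺ˡ _ p
  ... | false = cong (_∧ true) p

count-∖-< : (X Y : Subset n) {v : Fin n} → v ∈ X → v ∈ Y → count (X ∖ Y) < count X
count-∖-< X Y {v} v∈X v∈Y = ≤-trans (s≤s (count-mono sub)) (≤-reflexive (sym (count-remove X v∈X)))
  where
  sub : X ∖ Y ⊆ X - v
  sub i p = ∈-⁺ X (∈∖⁻ˡ X Y p) λ { refl → true≢false v∈Y (∈∖⁻ʳ X Y p) }

count>0⇒∃ : (X : Subset n) → 0 < count X → ∃[ v ] v ∈ X
count>0⇒∃ {suc n} X p with X zero in eq
... | true = zero , eq
... | false with count>0⇒∃ (X ∘ suc) p
...   | v , q = suc v , q

length≤count : (X : Subset n) (l : List (Fin n)) → Unique l → All (_∈ X) l → length l ≤ count X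
length≤count X [] _ _ = z≤n
length≤count X (v ∷ l) (v≢ ∷ u) (p ∷ ps) = ≤-trans
  (s≤s (length≤count (X - v) l u (All.zipWith (λ (q , v≢w) → ∈-⁺ X q (v≢w ∘ sym)) (ps , v≢))))
  (≤-reflexive (sym (count-remove X p)))

-- An element outside `l` would extend it to a duplicate-free list in `X` longer than `count X`.
-- This turns a degree bound into a complete list of neighbours.
count≤length⇒∈ : (X : Subset n) (l : List (Fin n)) → Unique l → All (_∈ X) l → count X ≤ length l →
  ∀ v → v ∈ X → v List.∈ l
count≤length⇒∈ X l u ps b v p with DecMembership._∈?_ _≟_ v l
... | yes q = q
... | no q = contradiction (≤-trans (length≤count X (v ∷ l) (Allₚ.¬Any⇒All¬ l q ∷ u) (p ∷ ps)) b) 1+n≰n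

all≡⇒count≤1 : (X : Subset n) (w : Fin n) → (∀ v → v ∈ X → v ≡ w) → count X ≤ 1
all≡⇒count≤1 X w h = ≤-trans (count-mono sub) (≤-reflexive (count-⁅⁆ w))
  where
  sub : X ⊆ ⁅ w ⁆
  sub v p rewrite h v p = ==-refl w

-- Induction on the domain: once `zero` is mapped, its image is removed from `Y`, and injectivity
-- keeps the other images inside the rest.
count-injective : (X : Subset n) (Y : Subset m) (f : Fin n → Fin m) → (∀ {i j} → f i ≡ f j → i ≡ j) →
  (∀ i → i ∈ X → f i ∈ Y) → count X ≤ count Y
count-injective {zero} X Y f inj h = z≤n
count-injective {suc n} X Y f inj h with X zero in eq
... | false = count-injective (X ∘ suc) Y (f ∘ suc) (suc-injective ∘ inj) (h ∘ suc)
... | true = ≤-trans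
  (s≤s (count-injective (X ∘ suc) (Y - f zero) (f ∘ suc) (suc-injective ∘ inj)
    λ i p → ∈-⁺ Y (h (suc i) p) λ e → contradiction (inj e) λ ()))
  (≤-reflexive (sym (count-remove Y (h zero eq))))

count-+ : ∀ n m (X : Subset (n + m)) → count X ≡ count (λ i → X (i ↑ˡ m)) + count (λ i → X (n ↑ʳ i))
count-+ zero m X = refl
count-+ (suc n) m X with X zero
... | true = cong suc (count-+ n m (X ∘ suc))
... | false = count-+ n m (X ∘ suc)

-- Independent sets in induced subgraphs

degIn : Adj n → Subset n → Fin n → ℕ
degIn adj W v = count (adj v ∩ W)

N[_] : Fin n → Adj n → Subset n
N[ v ] adj = ⁅ v ⁆ ∪ adj v

Subcubic : Adj n → Subset n → Set
Subcubic adj W = ∀ v → v ∈ W → degIn adj W v ≤ 3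

-- The surplus e is what the inductions trade: it becomes the number of leaves in the end.
record Packing (adj : Adj n) (W : Subset n) (e : ℕ) : Set where
  constructor packing
  field
    S           : Subset n
    S⊆W         : S ⊆ W
    independent : Independent adj S
    bound       : count W + e ≤ 3 * count S


∩-∈ : (X Y : Subset n) {v : Fin n} → v ∈ X → v ∈ Y → v ∈ X ∩ Y
∩-∈ X Y p q = cong₂ _∧_ p q

∩-monoʳ : (X : Subset n) {Y Z : Subset n} → Y ⊆ Z → X ∩ Y ⊆ X ∩ Z
∩-monoʳ X h v p = cong₂ _∧_ (∧-conicalˡ (X v) _ p) (h v (∧-conicalʳ (X v) _ p))

∖-⊆ : (X Y : Subset n) → X ∖ Y ⊆ X
∖-⊆ X Y v = ∈∖⁻ˡ X Y

Subcubic-⊆ : (adj : Adj n) {W W′ : Subset n} → W′ ⊆ W → Subcubic adj W → Subcubic adj W′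
Subcubic-⊆ adj h c v p = ≤-trans (count-mono (∩-monoʳ (adj v) h)) (c v (h v p))

adj⇒≢ : {adj : Adj n} → IsSimple adj → ∀ {i j} → adj i j ≡ true → i ≢ j
adj⇒≢ (_ , irr) {i} p refl = true≢false p (irr i)

∅-packing : (adj : Adj n) (W : Subset n) → count W ≤ 0 → Packing adj W 0
∅-packing adj W h = packing ∅ (λ _ ()) (λ _ _ ()) (≤-trans (≤-reflexive (+-identityʳ _)) (≤-trans h z≤n))

-- The basic exchange: the new vertex `t` contributes 3, which pays for the deleted part of `W`, and
-- the difference is booked as a change of surplus from `e` to `e′`. The set `X` may be smaller than
-- the closed neighbourhood of `t`: non-adjacency is demanded only towards the vertices already
-- chosen. Triangles are deleted in this way.
extend : {adj : Adj n} → IsSimple adj → (W X : Subset n) {t : Fin n} {e e′ : ℕ} →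
  t ∈ W → t ∈ X → count (X ∩ W) + e′ ≤ 3 + e →
  (P : Packing adj (W ∖ X) e) → (∀ s → s ∈ Packing.S P → adj t s ≡ false) → Packing adj W e′
extend {adj = adj} (symm , irr) W X {t} {e} {e′} t∈W t∈X h (packing S S⊆ ind bound) free =
  packing (⁅ t ⁆ ∪ S) sub indep bound′
  where
  sub : ⁅ t ⁆ ∪ S ⊆ W
  sub i p with ∨-true⁻ {i == t} p
  ... | inj₁ q rewrite ==⇒≡ i t q = t∈W
  ... | inj₂ q = ∈∖⁻ˡ W X (S⊆ i q)
  indep : Independent adj (⁅ t ⁆ ∪ S)
  indep i j p q with ∨-true⁻ {i == t} p | ∨-true⁻ {j == t} q
  ... | inj₁ a | inj₁ b rewrite ==⇒≡ i t a | ==⇒≡ j t b = irr t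
  ... | inj₁ a | inj₂ b rewrite ==⇒≡ i t a = free j b
  ... | inj₂ a | inj₁ b rewrite ==⇒≡ j t b = trans (symm i t) (free i a)
  ... | inj₂ a | inj₂ b = ind i j a b
  disj : ∀ i → i ∈ ⁅ t ⁆ → i ∉ S
  disj i p rewrite ==⇒≡ i t p = ¬-not λ q → true≢false t∈X (∈∖⁻ʳ W X (S⊆ t q))
  open ≤-Reasoning
  bound′ : count W + e′ ≤ 3 * count (⁅ t ⁆ ∪ S)
  bound′ = begin
    count W + e′                                ≤⟨ +-monoˡ-≤ e′ (count-∖-≤ W X) ⟩
    count (X ∩ W) + count (W ∖ X) + e′          ≡⟨ shuffle (count (X ∩ W)) _ e′ ⟩
    count (X ∩ W) + e′ + count (W ∖ X)          ≤⟨ +-monoˡ-≤ _ h ⟩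
    3 + e + count (W ∖ X)                       ≡⟨ cong (3 +_) (+-comm e _) ⟩
    3 + (count (W ∖ X) + e)                     ≤⟨ +-monoʳ-≤ 3 bound ⟩
    3 + 3 * count S                             ≡⟨ *-suc 3 (count S) ⟨
    3 * (1 + count S)                           ≡⟨ cong (λ k → 3 * (k + count S)) (count-⁅⁆ t) ⟨
    3 * (count ⁅ t ⁆ + count S)                 ≡⟨ cong (3 *_) (count-∪-disjoint ⁅ t ⁆ S disj) ⟩
    3 * count (⁅ t ⁆ ∪ S)                       ∎
    where
    shuffle : ∀ a b c → a + b + c ≡ a + c + b
    shuffle = solve-∀

-- Here the deleted set is the closed neighbourhood of `v`, with at most `d + 1` vertices. Thus
-- degree 1 earns one unit of surplus, degree 2 keeps the balance and degree 3 costs one unit.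
pick : {adj : Adj n} → IsSimple adj → (W : Subset n) {v : Fin n} (d : ℕ) {e e′ : ℕ} →
  v ∈ W → degIn adj W v ≤ d → d + e′ ≤ 2 + e → Packing adj (W ∖ N[ v ] adj) e → Packing adj W e′
pick {adj = adj} simple W {v} d {e} {e′} v∈W deg≤ h P =
  extend simple W (N[ v ] adj) v∈W (∨-true⁺ˡ _ (==-refl v))
    (≤-trans (+-monoˡ-≤ e′ N-count) (s≤s h)) P
    (λ s p → ¬-not λ q → true≢false (∨-true⁺ʳ (s == v) q) (∈∖⁻ʳ W (N[ v ] adj) (Packing.S⊆W P s p)))
  where
  sub : N[ v ] adj ∩ W ⊆ ⁅ v ⁆ ∪ (adj v ∩ W)
  sub i p with i ≟ v
  ... | yes _ = refl
  ... | no _ = p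
  N-count : count (N[ v ] adj ∩ W) ≤ suc d
  N-count = ≤-trans (count-mono sub) (≤-trans (count-∪-≤ ⁅ v ⁆ (adj v ∩ W))
    (+-mono-≤ (≤-reflexive (count-⁅⁆ v)) deg≤))

record Triangle (adj : Adj n) (W : Subset n) (x y z : Fin n) : Set where
  constructor triangle
  field
    x∈ : x ∈ W
    y∈ : y ∈ W
    z∈ : z ∈ W
    xy : adj x y ≡ true
    xz : adj x z ≡ true
    yz : adj y z ≡ true

-- Triangle-free induced subgraphs

TriangleFree : Adj n → Subset n → Set
TriangleFree adj W = ∀ x y z → ¬ Triangle adj W x y z

module _ (adj : Adj n) (simple : IsSimple adj) where

  private
    symm = proj₁ simple

  -- A second neighbour of v loses a neighbour when N[v] is deleted, so the deletion leaves
  -- a vertex of degree at most 2 behind.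
  low-degree-survivor : (W : Subset n) → Subcubic adj W → TriangleFree adj W → ∀ {v a} → v ∈ W →
    a ∈ adj v ∩ W → 2 ≤ degIn adj W a →
    ∃[ b ] (b ∈ W ∖ N[ v ] adj × degIn adj (W ∖ N[ v ] adj) b ≤ 2)
  low-degree-survivor W cubic tf {v} {a} v∈W a∈ deg≥2
    -- Since `a` has degree at least 2 it has a neighbour `b` other than `v`; triangle-freeness
    -- keeps `b` away from `v`.
    with count>0⇒∃ (adj a ∩ W - v) (≤-pred (≤-trans deg≥2 (≤-reflexive (count-remove (adj a ∩ W)
           (∩-∈ (adj a) W (trans (symm a v) (∧-conicalˡ _ _ a∈)) v∈W)))))
  ... | b , b∈ = b , b∈W′ , ≤-pred (≤-trans (s≤s (count-mono assoc)) (≤-trans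
          (count-∖-< (adj b ∩ W) (N[ v ] adj) (∩-∈ (adj b) W (trans (symm b a) ab) a∈W) (∨-true⁺ʳ (a == v) va))
          (cubic b b∈W)))
    where
    va = ∧-conicalˡ (adj v a) _ a∈
    a∈W = ∧-conicalʳ (adj v a) _ a∈
    ab∈ = ∈∖⁻ˡ (adj a ∩ W) ⁅ v ⁆ b∈
    ab = ∧-conicalˡ (adj a b) _ ab∈
    b∈W = ∧-conicalʳ (adj a b) _ ab∈
    b∉N : b ∉ N[ v ] adj
    b∉N = ¬-not λ p → [ (λ q → true≢false q (∈∖⁻ʳ (adj a ∩ W) ⁅ v ⁆ b∈))
                      , (λ vb → tf v a b (triangle v∈W a∈W b∈W va vb ab)) ]′ (∨-true⁻ {b == v} p)
    b∈W′ : b ∈ W ∖ N[ v ] adj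
    b∈W′ = ∈∖⁺ W (N[ v ] adj) b∈W b∉N
    assoc : adj b ∩ (W ∖ N[ v ] adj) ⊆ (adj b ∩ W) ∖ N[ v ] adj
    assoc i p = ∈∖⁺ (adj b ∩ W) (N[ v ] adj)
      (∩-∈ (adj b) W (∧-conicalˡ (adj b i) _ p) (∈∖⁻ˡ W (N[ v ] adj) (∧-conicalʳ (adj b i) _ p)))
      (∈∖⁻ʳ W (N[ v ] adj) (∧-conicalʳ (adj b i) _ p))

  TriangleFree-∖ : (W X : Subset n) → TriangleFree adj W → TriangleFree adj (W ∖ X)
  TriangleFree-∖ W X tf x y z (triangle x∈ y∈ z∈ xy xz yz) =
    tf x y z (triangle (∈∖⁻ˡ W X x∈) (∈∖⁻ˡ W X y∈) (∈∖⁻ˡ W X z∈) xy xz yz)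

  -- Mutual induction on a bound for the number of vertices. A vertex of degree at most 2 gives even
  -- surplus 1; otherwise deleting the closed neighbourhood of a vertex of degree 3 creates such a
  -- vertex, whose surplus covers the loss.
  triangle-free-packing : ∀ k (W : Subset n) → count W ≤ k → Subcubic adj W → TriangleFree adj W →
    Packing adj W 0
  -- A vertex of degree at most 1, either `v` or a neighbour of it, earns the surplus directly. If
  -- there is none, `v` has degree 2 and its deletion costs nothing but hands the low degree on to a
  -- survivor.
  triangle-free-packing-low : ∀ k (W : Subset n) → count W ≤ k → Subcubic adj W → TriangleFree adj W →
    ∀ {v} → v ∈ W → degIn adj W v ≤ 2 → Packing adj W 1

  private
    shrink : ∀ {k} (W : Subset n) {v} → count W ≤ suc k → v ∈ W → count (W ∖ N[ v ] adj) ≤ k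
    shrink W {v} b v∈W = ≤-pred (≤-trans (count-∖-< W (N[ v ] adj) v∈W (∨-true⁺ˡ _ (==-refl v))) b)

    weaken : (W : Subset n) → Packing adj W 1 → Packing adj W 0
    weaken W (packing S a b c) = packing S a b (≤-trans (+-monoʳ-≤ (count W) z≤n) c)

  triangle-free-packing zero W b _ _ = ∅-packing adj W b
  triangle-free-packing (suc k) W b cubic tf with 1 ≤? count W
  ... | no W-empty = ∅-packing adj W (≤-pred (≰⇒> W-empty))
  ... | yes nonempty with count>0⇒∃ W nonempty
  ...   | v , v∈W with degIn adj W v ≤? 2
  ...     | yes low = weaken W (triangle-free-packing-low (suc k) W b cubic tf v∈W low)
  ...     | no high with count>0⇒∃ (adj v ∩ W) (≤-trans (s≤s z≤n) (≰⇒> high))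
  ...       | a , a∈ with degIn adj W a ≤? 2
  ...         | yes low = weaken W (triangle-free-packing-low (suc k) W b cubic tf (∧-conicalʳ (adj v a) _ a∈) low)
  ...         | no high′ with low-degree-survivor W cubic tf v∈W a∈ (≤-trans (n≤1+n 2) (≰⇒> high′))
  -- Up to four vertices are deleted for a gain of three; the missing unit is the surplus 1 of the
  -- remainder.
  ...           | c , c∈ , low = pick simple W 3 v∈W (cubic v v∈W) ≤-refl
    (triangle-free-packing-low k (W ∖ N[ v ] adj) (shrink W b v∈W)
      (Subcubic-⊆ adj (∖-⊆ W _) cubic) (TriangleFree-∖ W _ tf) c∈ low)

  triangle-free-packing-low zero W b _ _ v∈W _ =
    contradiction (≤-trans (length≤count W (_ ∷ []) ([] ∷ []) (v∈W ∷ [])) b) λ ()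
  triangle-free-packing-low (suc k) W b cubic tf {v} v∈W low with degIn adj W v ≤? 1
  ... | yes deg≤1 = pick simple W 1 v∈W deg≤1 ≤-refl
    (triangle-free-packing k _ (shrink W b v∈W) (Subcubic-⊆ adj (∖-⊆ W _) cubic) (TriangleFree-∖ W _ tf))
  ... | no deg≰1 with count>0⇒∃ (adj v ∩ W) (≤-trans (s≤s z≤n) (≰⇒> deg≰1))
  ...   | a , a∈ with degIn adj W a ≤? 1
  ...     | yes deg≤1 = pick simple W 1 a∈W deg≤1 ≤-refl
    (triangle-free-packing k _ (shrink W b a∈W) (Subcubic-⊆ adj (∖-⊆ W _) cubic) (TriangleFree-∖ W _ tf))
    where a∈W = ∧-conicalʳ (adj v a) _ a∈
  ...     | no high with low-degree-survivor W cubic tf v∈W a∈ (≰⇒> high)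
  -- At most three vertices are deleted for a gain of three, so the surplus 1 of the remainder is
  -- passed on unchanged.
  ...       | c , c∈ , low′ = pick simple W 2 v∈W low ≤-refl
    (triangle-free-packing-low k (W ∖ N[ v ] adj) (shrink W b v∈W)
      (Subcubic-⊆ adj (∖-⊆ W _) cubic) (TriangleFree-∖ W _ tf) c∈ low′)

-- Subcubic graphs without K₄

record K₄ (adj : Adj n) (W : Subset n) (a b c d : Fin n) : Set where
  constructor k₄
  field
    a∈ : a ∈ W
    b∈ : b ∈ W
    c∈ : c ∈ W
    d∈ : d ∈ W
    ab : adj a b ≡ true
    ac : adj a c ≡ true
    ad : adj a d ≡ true
    bc : adj b c ≡ true
    bd : adj b d ≡ true
    cd : adj c d ≡ true

K₄-Free : Adj n → Subset n → Set
K₄-Free adj W = ∀ a b c d → ¬ K₄ adj W a b c d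

module _ {adj : Adj n} (simple : IsSimple adj) {W : Subset n} where

  private
    flip : ∀ {i j} → adj i j ≡ true → adj j i ≡ true
    flip {i} {j} p = trans (proj₁ simple j i) p

  -- The three adjacent transpositions generate all orders of the four vertices, so claims about the
  -- first vertex or the first pair transfer to every vertex and every edge.
  K₄-swap₁₂ : ∀ {a b c d} → K₄ adj W a b c d → K₄ adj W b a c d
  K₄-swap₁₂ (k₄ a b c d ab ac ad bc bd cd) = k₄ b a c d (flip ab) bc bd ac ad cd

  K₄-swap₂₃ : ∀ {a b c d} → K₄ adj W a b c d → K₄ adj W a c b d
  K₄-swap₂₃ (k₄ a b c d ab ac ad bc bd cd) = k₄ a c b d ac ab ad (flip bc) cd bd

  K₄-swap₃₄ : ∀ {a b c d} → K₄ adj W a b c d → K₄ adj W a b d c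
  K₄-swap₃₄ (k₄ a b c d ab ac ad bc bd cd) = k₄ a b d c ab ad ac bd bc (flip cd)

  -- The other three vertices already use up the degree of `a`, so no edge leaves the K₄.
  K₄-neighbours : ∀ {a b c d} → Subcubic adj W → K₄ adj W a b c d →
    ∀ v → v ∈ adj a ∩ W → v List.∈ b ∷ c ∷ d ∷ []
  K₄-neighbours {a} cubic (k₄ a∈ b∈ c∈ d∈ ab ac ad bc bd cd) = count≤length⇒∈ (adj a ∩ W) _
    ((adj⇒≢ simple bc ∷ adj⇒≢ simple bd ∷ []) ∷ (adj⇒≢ simple cd ∷ []) ∷ [] ∷ [])
    (∩-∈ (adj a) W ab b∈ ∷ ∩-∈ (adj a) W ac c∈ ∷ ∩-∈ (adj a) W ad d∈ ∷ [])
    (cubic a a∈)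

-- Two triangles on the common edge `xy` with distinct tips `z` and `w`. An edge between the tips is
-- not excluded here; K₄-freeness excludes it.
record Diamond (adj : Adj n) (W : Subset n) (x y z w : Fin n) : Set where
  constructor diamond
  field
    tri : Triangle adj W x y z
    w∈  : w ∈ W
    xw  : adj x w ≡ true
    yw  : adj y w ≡ true
    z≢w : z ≢ w

triangle? : (adj : Adj n) (W : Subset n) → Dec (∃[ x ] ∃[ y ] ∃[ z ] Triangle adj W x y z)
triangle? adj W = map′
  (λ { (x , y , z , a , b , c , d , e , f) → x , y , z , triangle a b c d e f })
  (λ { (x , y , z , triangle a b c d e f) → x , y , z , a , b , c , d , e , f })
  (any? λ x → any? λ y → any? λ z → (W x ≟ᵇ true) ×-dec (W y ≟ᵇ true) ×-dec (W z ≟ᵇ true)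
    ×-dec (adj x y ≟ᵇ true) ×-dec (adj x z ≟ᵇ true) ×-dec (adj y z ≟ᵇ true))

diamond? : (adj : Adj n) (W : Subset n) → Dec (∃[ x ] ∃[ y ] ∃[ z ] ∃[ w ] Diamond adj W x y z w)
diamond? adj W = map′
  (λ { (x , y , z , w , (a , b , c , d , e , f) , g , h , i , j) →
       x , y , z , w , diamond (triangle a b c d e f) g h i j })
  (λ { (x , y , z , w , diamond (triangle a b c d e f) g h i j) →
       x , y , z , w , (a , b , c , d , e , f) , g , h , i , j })
  (any? λ x → any? λ y → any? λ z → any? λ w →
    ((W x ≟ᵇ true) ×-dec (W y ≟ᵇ true) ×-dec (W z ≟ᵇ true)
      ×-dec (adj x y ≟ᵇ true) ×-dec (adj x z ≟ᵇ true) ×-dec (adj y z ≟ᵇ true))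
    ×-dec (W w ≟ᵇ true) ×-dec (adj x w ≟ᵇ true) ×-dec (adj y w ≟ᵇ true) ×-dec ¬? (z ≟ w))

-- Adding an edge, and the K₄ it may create

addEdge : Fin n → Fin n → Adj n → Adj n
addEdge p q adj i j = adj i j ∨ ((i == p) ∧ (j == q) ∨ (i == q) ∧ (j == p))

NewEdge : (p q i j : Fin n) → Set
NewEdge p q i j = (i ≡ p × j ≡ q) ⊎ (i ≡ q × j ≡ p)

module _ (p q : Fin n) (adj : Adj n) where

  addEdge⁻ : ∀ i j → addEdge p q adj i j ≡ true → adj i j ≡ true ⊎ NewEdge p q i j
  addEdge⁻ i j e with ∨-true⁻ {adj i j} e
  ... | inj₁ old = inj₁ old
  ... | inj₂ new with ∨-true⁻ {(i == p) ∧ (j == q)} new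
  ...   | inj₁ u = inj₂ (inj₁ (==⇒≡ i p (∧-conicalˡ _ _ u) , ==⇒≡ j q (∧-conicalʳ (i == p) _ u)))
  ...   | inj₂ u = inj₂ (inj₂ (==⇒≡ i q (∧-conicalˡ _ _ u) , ==⇒≡ j p (∧-conicalʳ (i == q) _ u)))

  addEdge-new : addEdge p q adj p q ≡ true
  addEdge-new = ∨-true⁺ʳ (adj p q) (∨-true⁺ˡ _ (cong₂ _∧_ (==-refl p) (==-refl q)))

  addEdge-old : ∀ {i j} → addEdge p q adj i j ≡ true → j ≢ p → j ≢ q → adj i j ≡ true
  addEdge-old {i} {j} e j≢p j≢q with addEdge⁻ i j e
  ... | inj₁ old = old
  ... | inj₂ (inj₁ (_ , j≡q)) = contradiction j≡q j≢q
  ... | inj₂ (inj₂ (_ , j≡p)) = contradiction j≡p j≢p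

  addEdge-simple : p ≢ q → IsSimple adj → IsSimple (addEdge p q adj)
  addEdge-simple p≢q (symm , irr) = symm′ , λ i → ¬-not (irr′ i)
    where
    symm′ : ∀ i j → addEdge p q adj i j ≡ addEdge p q adj j i
    symm′ i j = cong₂ _∨_ (symm i j) (trans (∨-comm ((i == p) ∧ (j == q)) _)
      (cong₂ _∨_ (∧-comm (i == q) (j == p)) (∧-comm (i == p) (j == q))))
    irr′ : ∀ i → addEdge p q adj i i ≢ true
    irr′ i e with addEdge⁻ i i e
    ... | inj₁ old = true≢false old (irr i)
    ... | inj₂ (inj₁ (u , v)) = p≢q (trans (sym u) v)
    ... | inj₂ (inj₂ (u , v)) = p≢q (trans (sym v) u)

  -- The obstruction to adding `pq`: an old edge `cd` which, together with `p` and `q`, becomes a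
  -- K₄.
  CommonEdge : Subset n → Set
  CommonEdge W = ∃[ c ] ∃[ d ] (c ∈ W × d ∈ W × adj c d ≡ true ×
    adj p c ≡ true × adj p d ≡ true × adj q c ≡ true × adj q d ≡ true)

  -- The vertices `c` and `d` differ from `p` and `q`, and every edge of the K₄ other than `ab` has
  -- an end among them, so these five edges are old.
  new-edge⇒CommonEdge : {W : Subset n} → p ≢ q → IsSimple adj → ∀ {a b c d} →
    K₄ (addEdge p q adj) W a b c d → NewEdge p q a b → CommonEdge W
  new-edge⇒CommonEdge {W} p≢q simple (k₄ a∈ b∈ c∈ d∈ ab ac ad bc bd cd) = λ
    { (inj₁ (refl , refl)) →
        let old-c : ∀ {i} → addEdge p q adj i _ ≡ true → adj i _ ≡ true
            old-c e = addEdge-old e (≢-sym (≢ ac)) (≢-sym (≢ bc))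
            old-d : ∀ {i} → addEdge p q adj i _ ≡ true → adj i _ ≡ true
            old-d e = addEdge-old e (≢-sym (≢ ad)) (≢-sym (≢ bd))
        in _ , _ , c∈ , d∈ , old-d cd , old-c ac , old-d ad , old-c bc , old-d bd
    ; (inj₂ (refl , refl)) →
        let old-c : ∀ {i} → addEdge p q adj i _ ≡ true → adj i _ ≡ true
            old-c e = addEdge-old e (≢-sym (≢ bc)) (≢-sym (≢ ac))
            old-d : ∀ {i} → addEdge p q adj i _ ≡ true → adj i _ ≡ true
            old-d e = addEdge-old e (≢-sym (≢ bd)) (≢-sym (≢ ad))
        in _ , _ , c∈ , d∈ , old-d cd , old-c bc , old-d bd , old-c ac , old-d ad
    }
    where
    ≢ : ∀ {i j} → addEdge p q adj i j ≡ true → i ≢ j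
    ≢ = adj⇒≢ (addEdge-simple p≢q simple)

  addEdge-K₄-Free : (W : Subset n) → p ≢ q → IsSimple adj → K₄-Free adj W → ¬ CommonEdge W →
    K₄-Free (addEdge p q adj) W
  addEdge-K₄-Free W p≢q simple free none a b c d K@(k₄ a∈ b∈ c∈ d∈ ab ac ad bc bd cd) =
    -- Each of the six edges is moved to the front by swaps; there `old` excludes that it is the new
    -- one.
    free a b c d (k₄ a∈ b∈ c∈ d∈
      (old K ab) (old (s₂₃ K) ac) (old (s₂₃ (s₃₄ K)) ad)
      (old (s₂₃ (s₁₂ K)) bc) (old (s₂₃ (s₁₂ (s₃₄ K))) bd) (old (s₂₃ (s₃₄ (s₁₂ (s₂₃ K)))) cd))
    where
    simple′ = addEdge-simple p≢q simple
    s₁₂ = λ {a b c d} → K₄-swap₁₂ simple′ {W} {a} {b} {c} {d}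
    s₂₃ = λ {a b c d} → K₄-swap₂₃ simple′ {W} {a} {b} {c} {d}
    s₃₄ = λ {a b c d} → K₄-swap₃₄ simple′ {W} {a} {b} {c} {d}
    old : ∀ {a b c d} → K₄ (addEdge p q adj) W a b c d → addEdge p q adj a b ≡ true → adj a b ≡ true
    old {a} {b} K e with addEdge⁻ a b e
    ... | inj₁ o = o
    ... | inj₂ new = contradiction (new-edge⇒CommonEdge p≢q simple K new) none

-- Reductions at triangles and diamonds

record Admissible (adj : Adj n) (W : Subset n) : Set where
  constructor admissible
  field
    simple : IsSimple adj
    cubic  : Subcubic adj W
    free   : K₄-Free adj W

K₄-Free-⊆ : (adj : Adj n) {W W′ : Subset n} → W′ ⊆ W → K₄-Free adj W → K₄-Free adj W′
K₄-Free-⊆ adj h free a b c d (k₄ a∈ b∈ c∈ d∈ ab ac ad bc bd cd) =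
  free a b c d (k₄ (h a a∈) (h b b∈) (h c c∈) (h d d∈) ab ac ad bc bd cd)

Admissible-⊆ : {adj : Adj n} {W W′ : Subset n} → W′ ⊆ W → Admissible adj W → Admissible adj W′
Admissible-⊆ {adj = adj} h (admissible s c f) = admissible s (Subcubic-⊆ adj h c) (K₄-Free-⊆ adj h f)

-- Meant for the neighbourhood of a triangle vertex: `y` and `z` are the other two triangle vertices
-- and `p` is the outer neighbour, if there is one.
third-element : (X : Subset n) {y z : Fin n} → y ≢ z → y ∈ X → z ∈ X → count X ≤ 3 →
  (∃[ p ] (p ∈ X × p ≢ y × p ≢ z × (∀ u → u ∈ X → u List.∈ y ∷ z ∷ p ∷ []))) ⊎
  (∀ u → u ∈ X → u List.∈ y ∷ z ∷ [])
third-element X {y} {z} y≢z y∈ z∈ b with any? (λ p → (X p ≟ᵇ true) ×-dec ¬? (p ≟ y) ×-dec ¬? (p ≟ z))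
... | yes (p , p∈ , p≢y , p≢z) = inj₁ (p , p∈ , p≢y , p≢z , count≤length⇒∈ X _
  ((y≢z ∷ ≢-sym p≢y ∷ []) ∷ (≢-sym p≢z ∷ []) ∷ [] ∷ []) (y∈ ∷ z∈ ∷ p∈ ∷ []) b)
... | no none = inj₂ only
  where
  only : ∀ u → u ∈ X → u List.∈ y ∷ z ∷ []
  only u u∈ with u ≟ y | u ≟ z
  ... | yes u≡y | _ = here u≡y
  ... | no _ | yes u≡z = there (here u≡z)
  ... | no u≢y | no u≢z = contradiction (u , u∈ , u≢y , u≢z) none

-- The parameter `smaller` is the induction hypothesis. It ranges over all adjacency relations on
-- the same vertices because the reduction adds an edge; the measure is the size of `W`.
module TriangleReduction {n} {adj : Adj n} {W : Subset n} (adm : Admissible adj W)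
  {x y z : Fin n} (tri : Triangle adj W x y z)
  (smaller : ∀ (adj′ : Adj n) (W′ : Subset n) → count W′ < count W → Admissible adj′ W′ → Packing adj′ W′ 0) where

  open Admissible adm
  open Triangle tri

  Δ W′ : Subset n
  Δ = ⟦ x ∷ y ∷ z ∷ [] ⟧
  W′ = W ∖ Δ

  private
    symm = proj₁ simple
    x∈Δ = ∈⟦⟧⁺ (x ∷ y ∷ z ∷ []) (here refl)
    y∈Δ = ∈⟦⟧⁺ (x ∷ y ∷ z ∷ []) (there (here refl))
    z∈Δ = ∈⟦⟧⁺ (x ∷ y ∷ z ∷ []) (there (there (here refl)))

    count-Δ : count (Δ ∩ W) + 0 ≤ 3
    count-Δ = ≤-trans (≤-reflexive (+-identityʳ _)) (≤-trans
      (count-mono {X = Δ ∩ W} {Δ} λ i → ∧-conicalˡ (Δ i) _) (count-⟦⟧ (x ∷ y ∷ z ∷ [])))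

    W′-smaller : count W′ < count W
    W′-smaller = count-∖-< W Δ x∈ x∈Δ

    ∉W′ : ∀ {v} → v ∈ Δ → ¬ (v ∈ W′)
    ∉W′ v∈Δ v∈W′ = true≢false v∈Δ (∈∖⁻ʳ W Δ v∈W′)

  -- With no neighbour of `x` outside the triangle, `x` can join any packing of the rest and pays
  -- for the three deleted vertices.
  closed : (∀ u → u ∈ adj x ∩ W → u List.∈ y ∷ z ∷ []) → Packing adj W 0
  closed cover = extend simple W Δ x∈ x∈Δ count-Δ P λ s s∈ → ¬-not λ xs → isolated s (Packing.S⊆W P s s∈) xs
    where
    P = smaller adj W′ W′-smaller (Admissible-⊆ (∖-⊆ W Δ) adm)
    isolated : ∀ s → s ∈ W′ → adj x s ≢ true
    isolated s s∈W′ xs with cover s (∩-∈ (adj x) W xs (∈∖⁻ˡ W Δ s∈W′))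
    ... | here refl = ∉W′ y∈Δ s∈W′
    ... | there (here refl) = ∉W′ z∈Δ s∈W′

  -- An independent set of the graph with the extra edge pq misses p or q, so it can be
  -- enlarged by x or by y.
  reduce : ∀ {p q} → p ≢ q → adj x p ≡ true → adj y q ≡ true →
    (∀ u → u ∈ adj x ∩ W → u List.∈ y ∷ z ∷ p ∷ []) →
    (∀ u → u ∈ adj y ∩ W → u List.∈ x ∷ z ∷ q ∷ []) →
    ¬ CommonEdge p q adj W′ → Packing adj W 0
  reduce {p} {q} p≢q xp yq cover-x cover-y none = choose
    where
    adj′ = addEdge p q adj

    -- The possible new neighbour `r` of `v` is compensated by the neighbour `t`, which disappears
    -- with the triangle. It serves `p`, which loses `x`, and `q`, which loses `y`.
    degree-swap : ∀ {v r t} → t ∈ W → t ∈ Δ → adj v t ≡ true → adj′ v ⊆ ⁅ r ⁆ ∪ adj v →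
      degIn adj′ W′ v ≤ degIn adj W v
    degree-swap {v} {r} {t} t∈W t∈Δ vt h = ≤-trans (count-mono sub)
      (≤-trans (count-∪-≤ ⁅ r ⁆ ((adj v ∩ W) - t)) (≤-reflexive
        (trans (cong (_+ count ((adj v ∩ W) - t)) (count-⁅⁆ r))
          (sym (count-remove (adj v ∩ W) (∩-∈ (adj v) W vt t∈W))))))
      where
      sub : adj′ v ∩ W′ ⊆ ⁅ r ⁆ ∪ ((adj v ∩ W) - t)
      sub i e with ∨-true⁻ {i == r} (h i (∧-conicalˡ (adj′ v i) _ e))
      ... | inj₁ i≡r = ∨-true⁺ˡ _ i≡r
      ... | inj₂ vi = ∨-true⁺ʳ (i == r) (∈-⁺ (adj v ∩ W) (∩-∈ (adj v) W vi (∈∖⁻ˡ W Δ i∈W′))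
                        λ { refl → ∉W′ t∈Δ i∈W′ })
        where i∈W′ = ∧-conicalʳ (adj′ v i) _ e

    cubic′ : Subcubic adj′ W′
    cubic′ v v∈W′ = cases (v ≟ p) (v ≟ q)
      where
      cases : Dec (v ≡ p) → Dec (v ≡ q) → degIn adj′ W′ v ≤ 3
      cases (yes refl) _ = ≤-trans (degree-swap x∈ x∈Δ (trans (symm v x) xp) sub) (cubic v (∈∖⁻ˡ W Δ v∈W′))
        where
        sub : adj′ v ⊆ ⁅ q ⁆ ∪ adj v
        sub i e with addEdge⁻ p q adj v i e
        ... | inj₁ old = ∨-true⁺ʳ (i == q) old
        ... | inj₂ (inj₁ (_ , refl)) = ∨-true⁺ˡ _ (==-refl q)
        ... | inj₂ (inj₂ (p≡q , _)) = contradiction p≡q p≢q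
      cases (no _) (yes refl) = ≤-trans (degree-swap y∈ y∈Δ (trans (symm v y) yq) sub) (cubic v (∈∖⁻ˡ W Δ v∈W′))
        where
        sub : adj′ v ⊆ ⁅ p ⁆ ∪ adj v
        sub i e with addEdge⁻ p q adj v i e
        ... | inj₁ old = ∨-true⁺ʳ (i == p) old
        ... | inj₂ (inj₁ (q≡p , _)) = contradiction (sym q≡p) p≢q
        ... | inj₂ (inj₂ (_ , refl)) = ∨-true⁺ˡ _ (==-refl p)
      cases (no v≢p) (no v≢q) = ≤-trans (count-mono sub) (cubic v (∈∖⁻ˡ W Δ v∈W′))
        where
        sub : adj′ v ∩ W′ ⊆ adj v ∩ W
        sub i e with addEdge⁻ p q adj v i (∧-conicalˡ (adj′ v i) _ e)
        ... | inj₁ old = ∩-∈ (adj v) W old (∈∖⁻ˡ W Δ (∧-conicalʳ (adj′ v i) _ e))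
        ... | inj₂ (inj₁ (v≡p , _)) = contradiction v≡p v≢p
        ... | inj₂ (inj₂ (v≡q , _)) = contradiction v≡q v≢q

    P′ : Packing adj′ W′ 0
    P′ = smaller adj′ W′ W′-smaller (admissible (addEdge-simple p q adj p≢q simple) cubic′
      (addEdge-K₄-Free p q adj W′ p≢q simple (K₄-Free-⊆ adj (∖-⊆ W Δ) free) none))

    open Packing P′

    P : Packing adj W′ 0
    -- A set independent in the graph with the extra edge is independent in the old graph.
    P = packing S S⊆W (λ i j i∈ j∈ → ¬-not λ ij →
      true≢false (∨-true⁺ˡ _ ij) (independent i j i∈ j∈)) bound

    choose : Packing adj W 0
    choose with S p in p∈S
    ... | false = extend simple W Δ x∈ x∈Δ count-Δ P λ s s∈ → ¬-not λ xs → free-x s s∈ xs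
      where
      free-x : ∀ s → s ∈ S → adj x s ≢ true
      free-x s s∈ xs with cover-x s (∩-∈ (adj x) W xs (∈∖⁻ˡ W Δ (S⊆W s s∈)))
      ... | here refl = ∉W′ y∈Δ (S⊆W s s∈)
      ... | there (here refl) = ∉W′ z∈Δ (S⊆W s s∈)
      ... | there (there (here refl)) = true≢false s∈ p∈S
    ... | true = extend simple W Δ y∈ y∈Δ count-Δ P λ s s∈ → ¬-not λ ys → free-y s s∈ ys
      where
      free-y : ∀ s → s ∈ S → adj y s ≢ true
      free-y s s∈ ys with cover-y s (∩-∈ (adj y) W ys (∈∖⁻ˡ W Δ (S⊆W s s∈)))
      ... | here refl = ∉W′ x∈Δ (S⊆W s s∈)
      ... | there (here refl) = ∉W′ z∈Δ (S⊆W s s∈)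
      ... | there (there (here refl)) = true≢false (addEdge-new p q adj) (independent p s p∈S s∈)

module _ {n} {adj : Adj n} {W : Subset n} (adm : Admissible adj W)
  (smaller : ∀ (adj′ : Adj n) (W′ : Subset n) → count W′ < count W → Admissible adj′ W′ → Packing adj′ W′ 0) where

  open Admissible adm

  private
    flip : ∀ {i j} → adj i j ≡ true → adj j i ≡ true
    flip {i} {j} p = trans (proj₁ simple j i) p

  -- With the edge from w to the third neighbour of z added, w has degree at most 2, so no K₄ arises.
  diamond-packing : ∀ {x y z w} → Diamond adj W x y z w → Packing adj W 0
  diamond-packing {x} {y} {z} {w} (diamond (triangle x∈ y∈ z∈ xy xz yz) w∈ xw yw z≢w)
    with third-element (adj z ∩ W) (adj⇒≢ simple xy) (∩-∈ (adj z) W (flip xz) x∈)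
           (∩-∈ (adj z) W (flip yz) y∈) (cubic z z∈)
  ... | inj₂ cover = TriangleReduction.closed adm (triangle z∈ x∈ y∈ (flip xz) (flip yz) xy) smaller cover
  ... | inj₁ (q , q∈ , q≢x , q≢y , cover-z) = R.reduce w≢q xw zq cover-x cover-z none
    where
    -- The vertices of the reduction are `x` and `z`: for `x` and `y` both outer neighbours would be
    -- `w`.
    module R = TriangleReduction adm (triangle x∈ z∈ y∈ xz xy (flip yz)) smaller
    zq = ∧-conicalˡ (adj z q) _ q∈
    w≢q : w ≢ q
    w≢q refl = free x y z w (k₄ x∈ y∈ z∈ w∈ xy xz xw yz yw zq)
    cover-x : ∀ u → u ∈ adj x ∩ W → u List.∈ z ∷ y ∷ w ∷ []
    cover-x = count≤length⇒∈ (adj x ∩ W) _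
      ((≢-sym (adj⇒≢ simple yz) ∷ z≢w ∷ []) ∷ (adj⇒≢ simple yw ∷ []) ∷ [] ∷ [])
      (∩-∈ (adj x) W xz z∈ ∷ ∩-∈ (adj x) W xy y∈ ∷ ∩-∈ (adj x) W xw w∈ ∷ [])
      (cubic x x∈)
    none : ¬ CommonEdge w q adj R.W′
    -- Counted in the old graph, `w` would have four neighbours: `x` and `y` in the deleted
    -- triangle, `c` and `d` outside it.
    none (c , d , c∈ , d∈ , cd , wc , wd , _) = contradiction (≤-trans
      (length≤count (adj w ∩ W) (x ∷ y ∷ c ∷ d ∷ [])
        ((adj⇒≢ simple xy ∷ x≢ c∈ ∷ x≢ d∈ ∷ []) ∷ (y≢ c∈ ∷ y≢ d∈ ∷ []) ∷ (adj⇒≢ simple cd ∷ []) ∷ [] ∷ [])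
        (∩-∈ (adj w) W (flip xw) x∈ ∷ ∩-∈ (adj w) W (flip yw) y∈ ∷
         ∩-∈ (adj w) W wc (∈∖⁻ˡ W R.Δ c∈) ∷ ∩-∈ (adj w) W wd (∈∖⁻ˡ W R.Δ d∈) ∷ []))
      (cubic w w∈)) λ { (s≤s (s≤s (s≤s ()))) }
      where
      x≢ : ∀ {v} → v ∈ R.W′ → x ≢ v
      x≢ v∈ refl = true≢false (∈⟦⟧⁺ (x ∷ z ∷ y ∷ []) (here refl)) (∈∖⁻ʳ W R.Δ v∈)
      y≢ : ∀ {v} → v ∈ R.W′ → y ≢ v
      y≢ v∈ refl = true≢false (∈⟦⟧⁺ (x ∷ z ∷ y ∷ []) (there (there (here refl)))) (∈∖⁻ʳ W R.Δ v∈)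

  -- Both obstacles to the reduction are diamonds: equal outer neighbours `p` and `q` give one on
  -- the edge `xy`, and a `CommonEdge` gives one on `cd` with tips `p` and `q`.
  diamond-free-triangle-packing : (∀ {x y z w} → ¬ Diamond adj W x y z w) →
    ∀ {x y z} → Triangle adj W x y z → Packing adj W 0
  diamond-free-triangle-packing df {x} {y} {z} tri@(triangle x∈ y∈ z∈ xy xz yz)
    with third-element (adj x ∩ W) (adj⇒≢ simple yz) (∩-∈ (adj x) W xy y∈)
           (∩-∈ (adj x) W xz z∈) (cubic x x∈)
       | third-element (adj y ∩ W) (adj⇒≢ simple xz) (∩-∈ (adj y) W (flip xy) x∈)
           (∩-∈ (adj y) W yz z∈) (cubic y y∈)
  ... | inj₂ cover | _ = TriangleReduction.closed adm tri smaller cover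
  ... | inj₁ _ | inj₂ cover =
    TriangleReduction.closed adm (triangle y∈ x∈ z∈ (flip xy) yz xz) smaller cover
  ... | inj₁ (p , p∈ , p≢y , p≢z , cover-x) | inj₁ (q , q∈ , q≢x , q≢z , cover-y) =
    R.reduce p≢q xp yq cover-x cover-y none
    where
    module R = TriangleReduction adm tri smaller
    xp = ∧-conicalˡ (adj x p) _ p∈
    yq = ∧-conicalˡ (adj y q) _ q∈
    p∈W = ∧-conicalʳ (adj x p) _ p∈
    q∈W = ∧-conicalʳ (adj y q) _ q∈
    p≢q : p ≢ q
    p≢q refl = df (diamond tri p∈W xp yq (≢-sym p≢z))
    none : ¬ CommonEdge p q adj R.W′
    none (c , d , c∈ , d∈ , cd , pc , pd , qc , qd) = df (diamond
      (triangle (∈∖⁻ˡ W R.Δ c∈) (∈∖⁻ˡ W R.Δ d∈) p∈W cd (flip pc) (flip pd)) q∈W (flip qc) (flip qd) p≢q)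

-- Brooks' theorem would give a 3-colouring and hence a colour class with a third of the vertices;
-- the induction finds such an independent set without colouring. The adjacency varies along with
-- `W`, since the triangle reduction changes it.
brooks-packing : ∀ k (adj : Adj n) (W : Subset n) → count W ≤ k → Admissible adj W → Packing adj W 0
brooks-packing zero adj W b _ = ∅-packing adj W b
brooks-packing (suc k) adj W b adm@(admissible simple cubic free) with diamond? adj W | triangle? adj W
... | yes (_ , _ , _ , _ , dia) | _ = diamond-packing adm
  (λ adj′ W′ lt → brooks-packing k adj′ W′ (≤-pred (≤-trans lt b))) dia
... | no ¬dia | yes (_ , _ , _ , tri) = diamond-free-triangle-packing adm
  (λ adj′ W′ lt → brooks-packing k adj′ W′ (≤-pred (≤-trans lt b))) (λ dia → ¬dia (_ , _ , _ , _ , dia)) tri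
... | no _ | no ¬tri = triangle-free-packing adj simple (count W) W ≤-refl cubic
  λ x y z tri → ¬tri (x , y , z , tri)

-- Connected graphs and their leaves

walk-closed : {adj : Adj n} (P : Fin n → Set) → (∀ i j → P i → adj i j ≡ true → P j) →
  ∀ {i j} → Walk adj i j → P i → P j
walk-closed P h here p = p
walk-closed P h (step e w) p = walk-closed P h w (h _ _ p e)

degree-full : (adj : Adj n) (v : Fin n) → degIn adj full v ≤ deg adj v
degree-full adj v = count-mono {X = adj v ∩ full} λ i → ∧-conicalˡ (adj v i) _

all-listed⇒≤length : (l : List (Fin n)) → (∀ v → v List.∈ l) → n ≤ length l
all-listed⇒≤length {n} l h = ≤-trans (≤-reflexive (sym (count-full n)))
  (≤-trans (count-mono {X = full} λ v _ → ∈⟦⟧⁺ l (h v)) (count-⟦⟧ l))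

another-vertex : 2 ≤ n → (v : Fin n) → ∃[ u ] v ≢ u
another-vertex (s≤s (s≤s _)) zero = suc zero , λ ()
another-vertex (s≤s (s≤s _)) (suc v) = zero , λ ()

connected⇒1≤deg : (adj : Adj n) → 2 ≤ n → Connected adj → ∀ v → 1 ≤ deg adj v
connected⇒1≤deg adj n≥2 conn v with another-vertex n≥2 v
... | u , v≢u with conn v u
...   | here = contradiction refl v≢u
...   | step {k = k} e _ = length≤count (adj v) (k ∷ []) ([] ∷ []) (e ∷ [])

-- By `K₄-neighbours` no edge leaves the four vertices, so connectedness puts every vertex among
-- them. The isomorphism sends a vertex to its position in `l`.
K₄⇒Iso : (adj : Adj n) → IsSimple adj → Connected adj → Subcubic adj full →
  ∀ {a b c d} → K₄ adj full a b c d → Iso adj (Kadj 4)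
K₄⇒Iso {n} adj simple@(symm , irr) conn cubic {a} {b} {c} {d} K@(k₄ _ _ _ _ ab ac ad bc bd cd) =
  f , g , g-f , (λ y → g-injective (g-f (g y))) ,
  λ i j → trans (sym (adj-g (f i) (f j))) (cong₂ adj (g-f i) (g-f j))
  where
  l : List (Fin n)
  l = a ∷ b ∷ c ∷ d ∷ []

  closed : ∀ i j → i List.∈ l → adj i j ≡ true → j List.∈ l
  closed i j i∈ ij = go i∈
    where
    s₁₂ : ∀ {a b c d} → K₄ adj full a b c d → K₄ adj full b a c d
    s₁₂ = K₄-swap₁₂ simple
    s₂₃ : ∀ {a b c d} → K₄ adj full a b c d → K₄ adj full a c b d
    s₂₃ = K₄-swap₂₃ simple
    s₃₄ : ∀ {a b c d} → K₄ adj full a b c d → K₄ adj full a b d c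
    s₃₄ = K₄-swap₃₄ simple
    nb : ∀ {a b c d} → K₄ adj full a b c d → a ≡ i → j List.∈ b ∷ c ∷ d ∷ []
    nb K refl = K₄-neighbours simple cubic K j (∩-∈ (adj i) full ij refl)
    -- Swaps bring `i` to the front of the K₄; the cases then translate the position of its
    -- neighbour back to the order of `l`.
    go : i List.∈ l → j List.∈ l
    go (here i≡a) = there (nb K (sym i≡a))
    go (there (here i≡b)) with nb (s₁₂ K) (sym i≡b)
    ... | here p = here p
    ... | there p = there (there p)
    go (there (there (here i≡c))) with nb (s₁₂ (s₂₃ K)) (sym i≡c)
    ... | here p = here p
    ... | there (here p) = there (here p)
    ... | there (there p) = there (there (there p))
    go (there (there (there (here i≡d)))) with nb (s₁₂ (s₂₃ (s₃₄ K))) (sym i≡d)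
    ... | here p = here p
    ... | there (here p) = there (here p)
    ... | there (there (here p)) = there (there (here p))

  listed : ∀ v → v List.∈ l
  listed v = walk-closed (List._∈ l) closed (conn a v) (here refl)

  f : Fin n → Fin 4
  f v = Any.index (listed v)

  g : Fin 4 → Fin n
  g = lookup l

  g-f : ∀ v → g (f v) ≡ v
  g-f v = sym (Anyₚ.lookup-index (listed v))

  adj-g : ∀ k k′ → adj (g k) (g k′) ≡ Kadj 4 k k′
  adj-g zero zero = irr a
  adj-g zero (suc zero) = ab
  adj-g zero (suc (suc zero)) = ac
  adj-g zero (suc (suc (suc zero))) = ad
  adj-g (suc zero) zero = trans (symm b a) ab
  adj-g (suc zero) (suc zero) = irr b
  adj-g (suc zero) (suc (suc zero)) = bc
  adj-g (suc zero) (suc (suc (suc zero))) = bd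
  adj-g (suc (suc zero)) zero = trans (symm c a) ac
  adj-g (suc (suc zero)) (suc zero) = trans (symm c b) bc
  adj-g (suc (suc zero)) (suc (suc zero)) = irr c
  adj-g (suc (suc zero)) (suc (suc (suc zero))) = cd
  adj-g (suc (suc (suc zero))) zero = trans (symm d a) ad
  adj-g (suc (suc (suc zero))) (suc zero) = trans (symm d b) bd
  adj-g (suc (suc (suc zero))) (suc (suc zero)) = trans (symm d c) cd
  adj-g (suc (suc (suc zero))) (suc (suc (suc zero))) = irr d

  g-injective : ∀ {k k′} → g k ≡ g k′ → k ≡ k′
  -- `Kadj 4` is false only on the diagonal, so irreflexivity at `g k` forces the positions to
  -- agree.
  g-injective {k} {k′} e = ==⇒≡ k k′ (not-injective
    (trans (sym (adj-g k k′)) (trans (cong (adj (g k)) (sym e)) (irr (g k)))))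

degreeClass : Adj n → ℕ → Subset n
degreeClass adj i v = deg adj v ≡ᵇ i

≡ᵇ-true⁻ : ∀ i j → (i ≡ᵇ j) ≡ true → i ≡ j
≡ᵇ-true⁻ i j e = ≡ᵇ⇒≡ i j (subst T (sym e) _)

≡ᵇ-true⁺ : ∀ {i j} → i ≡ j → (i ≡ᵇ j) ≡ true
≡ᵇ-true⁺ {i} refl = T⇒≡true (≡⇒≡ᵇ i i refl)
  where
  T⇒≡true : ∀ {b} → T b → b ≡ true
  T⇒≡true {true} _ = refl

-- Two adjacent leaves have no further neighbours, so by connectedness they would be the whole
-- graph, against `3 ≤ n`.
leaves-independent : (adj : Adj n) → IsSimple adj → 3 ≤ n → Connected adj →
  Independent adj (degreeClass adj 1)
leaves-independent adj (symm , irr) n≥3 conn u v u-leaf v-leaf = ¬-not λ uv →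
  contradiction (≤-trans n≥3 (all-listed⇒≤length (u ∷ v ∷ [])
    λ w → walk-closed (List._∈ u ∷ v ∷ []) (closed uv) (conn u w) (here refl)))
  λ { (s≤s (s≤s ())) }
  where
  only : ∀ {i j} → i ∈ degreeClass adj 1 → adj i j ≡ true → ∀ k → adj i k ≡ true → k List.∈ j ∷ []
  only {i} {j} leaf ij = count≤length⇒∈ (adj i) (j ∷ []) ([] ∷ []) (ij ∷ []) (≤-reflexive (≡ᵇ-true⁻ _ 1 leaf))
  closed : adj u v ≡ true → ∀ i j → i List.∈ u ∷ v ∷ [] → adj i j ≡ true → j List.∈ u ∷ v ∷ []
  closed uv i j (here refl) ij = there (only u-leaf uv j ij)
  closed uv i j (there (here refl)) ij with only v-leaf (trans (symm v u) uv) j ij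
  ... | here p = here p

-- Every picked leaf earns one unit of surplus. As leaves are pairwise non-adjacent, deleting the
-- closed neighbourhood of one spares the others, and their degrees can only drop. Once all are
-- used, `brooks-packing` handles the rest.
leaves-packing : ∀ k {adj : Adj n} (L W : Subset n) → count L ≡ k → L ⊆ W → Independent adj L →
  (∀ v → v ∈ L → degIn adj W v ≤ 1) → Admissible adj W → Packing adj W k
leaves-packing zero L W _ _ _ _ adm = brooks-packing (count W) _ W ≤-refl adm
leaves-packing (suc k) {adj} L W |L| L⊆W ind leaf adm with count>0⇒∃ L (≤-trans (s≤s z≤n) (≤-reflexive (sym |L|)))
... | v , v∈L = pick (Admissible.simple adm) W 1 (L⊆W v v∈L) (leaf v v∈L) ≤-refl
  (leaves-packing k (L - v) W′ (cong pred (trans (sym (count-remove L v∈L)) |L|)) sub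
    (λ i j i∈ j∈ → ind i j (∖-⊆ L ⁅ v ⁆ i i∈) (∖-⊆ L ⁅ v ⁆ j j∈))
    (λ i i∈ → ≤-trans (count-mono (∩-monoʳ (adj i) (∖-⊆ W (N[ v ] adj)))) (leaf i (∖-⊆ L ⁅ v ⁆ i i∈)))
    (Admissible-⊆ (∖-⊆ W (N[ v ] adj)) adm))
  where
  W′ = W ∖ N[ v ] adj
  sub : L - v ⊆ W′
  sub u u∈ = ∈∖⁺ W (N[ v ] adj) (L⊆W u u∈L)
    (cong₂ _∨_ (∈∖⁻ʳ L ⁅ v ⁆ u∈) (ind v u v∈L u∈L))
    where u∈L = ∖-⊆ L ⁅ v ⁆ u u∈

InG⇒packing : (adj : Adj n) → InG adj → Packing adj full (numDeg adj 1)
InG⇒packing adj (simple , conn , deg≤3 , ≇K₄ , n≥3) =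
  leaves-packing _ (degreeClass adj 1) full refl (λ _ _ → refl)
    (leaves-independent adj simple n≥3 conn)
    (λ v leaf → ≤-trans (degree-full adj v) (≤-reflexive (≡ᵇ-true⁻ _ 1 leaf)))
    (admissible simple cubic λ a b c d K → ≇K₄ (K₄⇒Iso adj simple conn cubic K))
  where
  cubic : Subcubic adj full
  cubic v _ = ≤-trans (degree-full adj v) (deg≤3 v)

-- The degrees 1, 2 and 3 partition the vertices, degree 0 being excluded by connectedness. This
-- rewrites three times the claimed bound as vertices plus leaves, the form of `bound` in a packing.
numDeg-sum : (adj : Adj n) → InG adj → 2 * numDeg adj 1 + numDeg adj 2 + numDeg adj 3 ≡ n + numDeg adj 1
numDeg-sum {n} adj (simple , conn , deg≤3 , _ , n≥3) = begin
  2 * n₁ + n₂ + n₃           ≡⟨ shuffle n₁ n₂ n₃ ⟩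
  n₁ + (n₂ + n₃) + n₁        ≡⟨ cong (λ k → n₁ + k + n₁) (count-∪-disjoint V₂ V₃ disjoint₂₃) ⟩
  n₁ + count (V₂ ∪ V₃) + n₁  ≡⟨ cong (_+ n₁) (count-∪-disjoint V₁ (V₂ ∪ V₃) disjoint₁) ⟩
  count (V₁ ∪ V₂ ∪ V₃) + n₁  ≡⟨ cong (_+ n₁) (≤-antisym (count-mono {X = V₁ ∪ V₂ ∪ V₃} {full} λ _ _ → refl)
                                               (count-mono {X = full} {V₁ ∪ V₂ ∪ V₃} λ v _ → cover v)) ⟩
  count {n} full + n₁        ≡⟨ cong (_+ n₁) (count-full n) ⟩
  n + n₁                     ∎
  where
  open ≡-Reasoning
  V₁ = degreeClass adj 1
  V₂ = degreeClass adj 2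
  V₃ = degreeClass adj 3
  n₁ = count V₁
  n₂ = count V₂
  n₃ = count V₃
  shuffle : ∀ a b c → 2 * a + b + c ≡ a + (b + c) + a
  shuffle = solve-∀
  disjoint₂₃ : ∀ v → v ∈ V₂ → v ∉ V₃
  disjoint₂₃ v p rewrite ≡ᵇ-true⁻ (deg adj v) 2 p = refl
  disjoint₁ : ∀ v → v ∈ V₁ → v ∉ V₂ ∪ V₃
  disjoint₁ v p rewrite ≡ᵇ-true⁻ (deg adj v) 1 p = refl
  cover : ∀ v → v ∈ V₁ ∪ V₂ ∪ V₃
  cover v with deg adj v | connected⇒1≤deg adj (≤-trans (n≤1+n 2) n≥3) conn v | deg≤3 v
  ... | 1 | _ | _ = refl
  ... | 2 | _ | _ = refl
  ... | 3 | _ | _ = refl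
  ... | suc (suc (suc (suc _))) | _ | s≤s (s≤s (s≤s ()))

-- The extremal classes

retract-injective : {A B : Set} (f : A → B) (g : B → A) → (∀ x → g (f x) ≡ x) → ∀ {x y} → f x ≡ f y → x ≡ y
retract-injective f g gf {x} {y} e = trans (sym (gf x)) (trans (cong g e) (gf y))

injective⇒≤ : (f : Fin n → Fin m) → (∀ {i j} → f i ≡ f j → i ≡ j) → n ≤ m
injective⇒≤ {n} {m} f inj = subst₂ _≤_ (count-full n) (count-full m)
  (count-injective full full f inj λ _ _ → refl)

-- `S ∘ g` is the image of `S` under `f`, since `g` is inverse to `f`.
Iso-independent : {adj : Adj n} {adj′ : Adj m} → ((f , g , _) : Iso adj adj′) (S : Subset n) →
  Independent adj S → Independent adj′ (S ∘ g) × count S ≤ count (S ∘ g)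
Iso-independent {adj = adj} {adj′} (f , g , gf , fg , hom) S ind =
  (λ i j i∈ j∈ → trans (sym (cong₂ adj′ (fg i) (fg j))) (trans (hom (g i) (g j)) (ind (g i) (g j) i∈ j∈))) ,
  count-injective S (S ∘ g) f (retract-injective f g gf) λ i i∈ → trans (cong S (gf i)) i∈

complete-independent : ∀ m {S : Subset m} → Independent (Kadj m) S → count S ≤ 1
complete-independent m {S} ind with count S ≤? 0
... | yes empty = ≤-trans empty z≤n
... | no nonempty with count>0⇒∃ S (≰⇒> nonempty)
...   | w , w∈ = all≡⇒count≤1 S w λ v v∈ → ==⇒≡ v w (not-injective (ind v w v∈ w∈))

-- Every extension adds one triangle, which holds at most one vertex of the set, while the trace on
-- the old vertices is independent in the old graph.
A-independent : {adj : Adj n} → IsA n adj → ∀ {S} → Independent adj S → 3 * count S ≤ n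
A-independent base ind = *-monoʳ-≤ 3 (complete-independent 3 ind)
A-independent (ext {n} {adj} a x _) {S} ind = begin
  3 * count S                 ≡⟨ cong (3 *_) (count-+ n 3 S) ⟩
  3 * (count Sˡ + count Sʳ)   ≡⟨ *-distribˡ-+ 3 (count Sˡ) (count Sʳ) ⟩
  3 * count Sˡ + 3 * count Sʳ ≤⟨ +-mono-≤ (A-independent a indˡ) (*-monoʳ-≤ 3 (complete-independent 3 indʳ)) ⟩
  n + 3                       ∎
  where
  open ≤-Reasoning
  Sˡ : Subset n
  Sˡ i = S (i ↑ˡ 3)
  Sʳ : Subset 3
  Sʳ i = S (n ↑ʳ i)
  indˡ : Independent adj Sˡ
  indˡ i j i∈ j∈ with ind _ _ i∈ j∈
  ... | e rewrite splitAt-↑ˡ n i 3 | splitAt-↑ˡ n j 3 = e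
  indʳ : Independent (Kadj 3) Sʳ
  indʳ i j i∈ j∈ with ind _ _ i∈ j∈
  ... | e rewrite splitAt-↑ʳ n 3 i | splitAt-↑ʳ n 3 j = e

-- The pendant edges form a perfect matching with `m` edges, and each has at most one end in the
-- set: the traces on path and pendant vertices are disjoint as subsets of `Fin m`.
B-independent : ∀ m {S : Subset (m + m)} → Independent (Badj m) S → count S ≤ m
B-independent m {S} ind = begin
  count S              ≡⟨ count-+ m m S ⟩
  count Sˡ + count Sʳ  ≡⟨ count-∪-disjoint Sˡ Sʳ (λ i p → ¬-not (matched i p)) ⟩
  count (Sˡ ∪ Sʳ)      ≤⟨ count-mono {X = Sˡ ∪ Sʳ} {full} (λ _ _ → refl) ⟩
  count {m} full       ≡⟨ count-full m ⟩
  m                    ∎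
  where
  open ≤-Reasoning
  Sˡ Sʳ : Subset m
  Sˡ i = S (i ↑ˡ m)
  Sʳ i = S (m ↑ʳ i)
  matched : ∀ i → S (i ↑ˡ m) ≡ true → S (m ↑ʳ i) ≢ true
  matched i p q with ind _ _ p q
  ... | e rewrite splitAt-↑ˡ m i m | splitAt-↑ʳ m m i = true≢false (==-refl i) e

pendant-neighbour : ∀ m (i : Fin m) u → Badj m (m ↑ʳ i) u ≡ true → u ≡ i ↑ˡ m
pendant-neighbour m i u e rewrite splitAt-↑ʳ m m i with splitAt m u in eq
... | inj₁ j = trans (sym (splitAt⁻¹-↑ˡ eq)) (cong (_↑ˡ m) (sym (==⇒≡ i j e)))

-- The `m` pendant vertices are carried by `g` to distinct leaves: each has only its path vertex as
-- a neighbour, and connectedness gives it at least one.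
B-leaves : {adj : Adj n} → InG adj → ((m , _) : InB adj) → m ≤ numDeg adj 1
B-leaves {n} {adj} (_ , conn , _ , _ , n≥3) (m , _ , f , g , gf , fg , hom) =
  ≤-trans (≤-reflexive (sym (count-full m)))
    (count-injective full (degreeClass adj 1) (λ i → g (m ↑ʳ i))
      (λ e → ↑ʳ-injective m _ _ (retract-injective g f fg e)) λ i _ → ≡ᵇ-true⁺ (leaf i))
  where
  only : ∀ i v → adj (g (m ↑ʳ i)) v ≡ true → v ≡ g (i ↑ˡ m)
  only i v e = trans (sym (gf v)) (cong g (pendant-neighbour m i (f v)
    (trans (cong (λ u → Badj m u (f v)) (sym (fg (m ↑ʳ i)))) (trans (hom _ _) e))))
  leaf : ∀ i → deg adj (g (m ↑ʳ i)) ≡ 1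
  leaf i = ≤-antisym (all≡⇒count≤1 _ _ (only i)) (connected⇒1≤deg adj (≤-trans (n≤1+n 2) n≥3) conn _)

theorem6 : ∀ (n : ℕ) (adj : Adj n) (α : ℕ) → InG adj → IsIndependenceNumber adj α →
    (2 * numDeg adj 1 + numDeg adj 2 + numDeg adj 3 ≤ 3 * α) ×
    (InA adj ⊎ InB adj → 2 * numDeg adj 1 + numDeg adj 2 + numDeg adj 3 ≡ 3 * α)
theorem6 n adj α G ((S , S-ind , |S|≡α) , α-max) = lower , λ c → ≤-antisym lower (upper c)
  where
  open ≤-Reasoning
  lower : 2 * numDeg adj 1 + numDeg adj 2 + numDeg adj 3 ≤ 3 * α
  lower = begin
    2 * numDeg adj 1 + numDeg adj 2 + numDeg adj 3  ≡⟨ numDeg-sum adj G ⟩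
    n + numDeg adj 1                                ≡⟨ cong (_+ numDeg adj 1) (count-full n) ⟨
    count {n} full + numDeg adj 1                   ≤⟨ Packing.bound P ⟩
    3 * count (Packing.S P)                         ≤⟨ *-monoʳ-≤ 3 (α-max _ (Packing.independent P)) ⟩
    3 * α                                           ∎
    where P = InG⇒packing adj G

  upper′ : InA adj ⊎ InB adj → 3 * count S ≤ n + numDeg adj 1
  upper′ (inj₁ (m , adj′ , a , iso@(f , g , gf , fg , _))) with Iso-independent iso S S-ind
  ... | ind , S≤ = begin
    3 * count S         ≤⟨ *-monoʳ-≤ 3 S≤ ⟩
    3 * count (S ∘ g)   ≤⟨ A-independent a ind ⟩
    m                   ≤⟨ injective⇒≤ g (retract-injective g f fg) ⟩
    -- Here `n` alone is an upper bound, so together with `lower` there are no leaves in this case.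
    n                   ≤⟨ m≤m+n n _ ⟩
    n + numDeg adj 1    ∎
  upper′ (inj₂ b@(m , _ , iso@(f , g , gf , fg , _))) with Iso-independent iso S S-ind
  ... | ind , S≤ = begin
    3 * count S         ≤⟨ *-monoʳ-≤ 3 S≤ ⟩
    3 * count (S ∘ g)   ≤⟨ *-monoʳ-≤ 3 (B-independent m ind) ⟩
    3 * m               ≡⟨ triple m ⟩
    -- The graph has at least `m + m` vertices and at least `m` leaves.
    m + m + m           ≤⟨ +-mono-≤ (injective⇒≤ g (retract-injective g f fg)) (B-leaves G b) ⟩
    n + numDeg adj 1    ∎
    where
    triple : ∀ k → 3 * k ≡ k + k + k
    triple = solve-∀

  upper : InA adj ⊎ InB adj → 3 * α ≤ 2 * numDeg adj 1 + numDeg adj 2 + numDeg adj 3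
  upper c = begin
    3 * α                                           ≡⟨ cong (3 *_) |S|≡α ⟨
    3 * count S                                     ≤⟨ upper′ c ⟩
    n + numDeg adj 1                                ≡⟨ numDeg-sum adj G ⟨
    2 * numDeg adj 1 + numDeg adj 2 + numDeg adj 3  ∎
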